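{- Let $\mathcal{U}$ be a $\mathbb{Z}$-Ramsey ultrafilter on $\mathbb{Z}$ such that $\mathbb{Z}^+=\{z\in\mathbb{Z}: z>0\}\in\mathcal{U}$. If there exists a $1$-thin subset $A$ of $\mathbb{Z}$ such that $A\in\mathcal{U}$, then $\mathcal{U}$ is selective.
   Context: An ultrafilter is free if it is non-principal. $[\mathbb{Z}]^2$ denotes the set of $2$-element subsets of $\mathbb{Z}$. A free ultrafilter $\mathcal{U}$ on $\mathbb{Z}$ is $\mathbb{Z}$-Ramsey if, for every coloring $\chi:[\mathbb{Z}]^2\to\{0,1\}$ satisfying $\chi(\{g+x,g+y\})=\chi(\{x,y\})$ for all $\{x,y\}\in[\mathbb{Z}]^2$ and $g\in\mathbb{Z}$, there exists $U\in\mathcal{U}$ such that $\chi$ is constant on $[U]^2$. A subset $A$ of $\mathbb{Z}$ is $1$-thin if $|(g+A)\cap A|\leqslant 1$ for each $g\in\mathbb{Z}\setminus\{0\}$. A free ultrafilter $\mathcal{U}$ on an infinite set $X$ is selective if, for any partition $\mathcal{P}$ of $X$, either one cell of $\mathcal{P}$ is a member of $\mathcal{U}$, or some member of $\mathcal{U}$ meets each cell of $\mathcal{P}$ in at most one point. -}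

module Defs where

open import Algebra.Bundles using (AbelianGroup)
open import Algebra.Properties.Group using (∙-cancelˡ)
open import Data.Fin.Base using (Fin)
open import Data.Integer.Base using (ℤ; 0ℤ; _+_; _>_)
open import Data.Integer.Properties using (+-0-abelianGroup)
open import Data.Product.Base using (∃-syntax; _×_)
open import Data.Sum.Base using (_⊎_)
open import Function.Base using (_∘_)
open import Function.Bundles using (Func; _⇔_)
open import Level using (Level; 0ℓ; _⊔_) renaming (suc to lsuc)
open import Relation.Binary.Bundles using (Setoid)
import Relation.Binary.Construct.On as On
open import Relation.Binary.PropositionalEquality.Core using (_≡_; _≢_)
open import Relation.Binary.PropositionalEquality.Properties using (setoid)
open import Relation.Nullary.Negation.Core using (¬_)
open import Relation.Unary
  using (Pred; _∈_; _⊆_; _≐_; _∩_; _∪_; ∁; ｛_｝; Satisfiable)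
open import Relation.Unary.Relation.Binary.Equality using (≐-setoid)

private
  variable
    ℓ : Level
    X : Set

Family : Set → (ℓ : Level) → Set (lsuc (0ℓ ⊔ ℓ))
Family X ℓ = Pred (Pred X 0ℓ) ℓ

-- ∣ A ∣ ≤ 1
AtMostOne : Pred X 0ℓ → Set
AtMostOne A = ∀ {x y} → x ∈ A → y ∈ A → x ≡ y

-- `nonempty` and `ultra` are deliberately in positive form.  Classically they
-- say that ∅ is not a member and that A or its complement is; constructively,
-- applied to the subsets {x | P}, they entail excluded middle for P : Set, so
-- the classical reasoning usual with ultrafilters remains available.
record IsUltrafilter {X : Set} (𝒰 : Family X ℓ) : Set (lsuc 0ℓ ⊔ ℓ) where
  field
    nonempty : ∀ {A} → A ∈ 𝒰 → Satisfiable A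
    upward   : ∀ {A B} → A ∈ 𝒰 → A ⊆ B → B ∈ 𝒰
    meet     : ∀ {A B} → A ∈ 𝒰 → B ∈ 𝒰 → (A ∩ B) ∈ 𝒰
    ultra    : ∀ A → A ∈ 𝒰 ⊎ ∁ A ∈ 𝒰

Principal : Family X ℓ → Set (lsuc 0ℓ ⊔ ℓ)
Principal 𝒰 = ∃[ x ] (∀ A → A ∈ 𝒰 ⇔ x ∈ A)

record IsFreeUltrafilter {X : Set} (𝒰 : Family X ℓ) : Set (lsuc 0ℓ ⊔ ℓ) where
  field
    isUltrafilter : IsUltrafilter 𝒰
    nonprincipal  : ¬ Principal 𝒰

record IsPartition {X : Set} (𝒫 : Family X ℓ) : Set (lsuc 0ℓ ⊔ ℓ) where
  field
    nonempty : ∀ {C} → C ∈ 𝒫 → Satisfiable C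
    covers   : ∀ x → ∃[ C ] C ∈ 𝒫 × x ∈ C
    disjoint : ∀ {C D x} → C ∈ 𝒫 → D ∈ 𝒫 → x ∈ C → x ∈ D → C ≐ D

-- The level p of the partitions is a parameter only so that the definition
-- can be a small type.
record IsSelective (p : Level) {X : Set} (𝒰 : Family X ℓ)
       : Set (lsuc (0ℓ ⊔ p) ⊔ ℓ) where
  field
    isFreeUltrafilter : IsFreeUltrafilter 𝒰
    selects : (𝒫 : Family X p) → IsPartition 𝒫 →
              (∃[ C ] C ∈ 𝒫 × C ∈ 𝒰) ⊎
              (∃[ S ] S ∈ 𝒰 × (∀ {C} → C ∈ 𝒫 → AtMostOne (S ∩ C)))

record Pair (X : Set) : Set where
  constructor pair
  field
    fst snd  : X
    distinct : fst ≢ snd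

⟪_⟫ : Pair X → Pred X 0ℓ
⟪ pair x y _ ⟫ = ｛ x ｝ ∪ ｛ y ｝

-- Pairs are identified when they have the same elements.
[_]² : Set → Setoid 0ℓ 0ℓ
[ X ]² = On.setoid (≐-setoid X 0ℓ) (⟪_⟫ {X})

Coloring : Set → Set
Coloring X = Func [ X ]² (setoid (Fin 2))

ConstantOn : Coloring X → Pred X 0ℓ → Set
ConstantOn χ A = ∃[ c ] (∀ p → ⟪ p ⟫ ⊆ A → Func.to χ p ≡ c)

shift : ℤ → Pair ℤ → Pair ℤ
shift g (pair x y x≢y) =
  pair (g + x) (g + y) (x≢y ∘ ∙-cancelˡ +-0-group g x y)
  where open AbelianGroup +-0-abelianGroup using () renaming (group to +-0-group)

Invariant : Coloring ℤ → Set
Invariant χ = ∀ g p → Func.to χ (shift g p) ≡ Func.to χ p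

record IsℤRamsey (𝒰 : Family ℤ ℓ) : Set (lsuc 0ℓ ⊔ ℓ) where
  field
    isFreeUltrafilter : IsFreeUltrafilter 𝒰
    ramsey : (χ : Coloring ℤ) → Invariant χ → ∃[ A ] A ∈ 𝒰 × ConstantOn χ A

_⊕_ : ℤ → Pred ℤ 0ℓ → Pred ℤ 0ℓ
(g ⊕ A) z = ∃[ a ] a ∈ A × z ≡ g + a

OneThin : Pred ℤ 0ℓ → Set
OneThin A = ∀ g → g ≢ 0ℤ → AtMostOne ((g ⊕ A) ∩ A)

ℤ⁺ : Pred ℤ 0ℓ
ℤ⁺ z = z > 0ℤ

{-# OPTIONS --safe #-}
-- In a 1-thin set A a nonzero difference determines the pair realising it, so
-- every 2-coloring of [A]² is the restriction of an invariant coloring of [ℤ]².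
-- Hence 𝒰 is a Ramsey ultrafilter, and selectivity follows by coloring a pair
-- according to whether its points lie in the same cell of the partition.
module Submission where

open import Defs
open import Algebra.Properties.AbelianGroup using (∙-cancelˡ; ⁻¹-anti-homo‿-)
open import Axiom.ExcludedMiddle using (ExcludedMiddle)
open import Data.Bool.Base using (if_then_else_)
open import Data.Empty using (⊥-elim)
open import Data.Fin.Base using (Fin; zero; suc)
open import Data.Integer.Base using (ℤ; _+_; _-_; -_)
open import Data.Integer.Properties
  using (_≟_; +-0-abelianGroup; neg-injective; i-j≡0⇒i≡j)
open import Data.Integer.Tactic.RingSolver using (solve-∀)
open import Data.Product.Base using (∃-syntax; _×_; _,_; proj₁; proj₂)
open import Data.Sum.Base using (_⊎_; inj₁; inj₂)
open import Function.Base using (_∘_)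
open import Function.Bundles using (_⇔_; mk⇔)
open import Level using (Level; 0ℓ)
open import Relation.Binary.Core using (Rel)
open import Relation.Binary.Definitions using (Symmetric)
open import Relation.Binary.PropositionalEquality
  using (_≡_; _≢_; refl; sym; trans; cong; subst)
open import Relation.Nullary.Decidable.Core using (Dec; yes; no; does)
open import Relation.Nullary.Decidable using (does-⇔)
open import Relation.Nullary.Negation.Core using (¬_)
open import Relation.Unary using (Pred; _∈_; _⊆_; _≐_; _∩_)

private
  variable
    ℓ p : Level
    X : Set

ultrafilter⇒excludedMiddle : {𝒰 : Family X ℓ} → IsUltrafilter 𝒰 → ExcludedMiddle 0ℓ
ultrafilter⇒excludedMiddle isU {P} with IsUltrafilter.ultra isU (λ _ → P)
... | inj₁ P∈𝒰  = yes (proj₂ (IsUltrafilter.nonempty isU P∈𝒰))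
... | inj₂ ¬P∈𝒰 = no (proj₂ (IsUltrafilter.nonempty isU ¬P∈𝒰))

indicator : ∀ {P : Set} → Dec P → Fin 2
indicator P? = if does P? then suc zero else zero

indicator-cong : ∀ {P Q : Set} → P ⇔ Q → (P? : Dec P) (Q? : Dec Q) →
                 indicator P? ≡ indicator Q?
indicator-cong P⇔Q P? Q? = cong (if_then suc zero else zero) (does-⇔ P⇔Q P? Q?)

indicator≡1⇒ : ∀ {P : Set} (P? : Dec P) → indicator P? ≡ suc zero → P
indicator≡1⇒ (yes p) _ = p

indicator≡0⇒¬ : ∀ {P : Set} (P? : Dec P) → indicator P? ≡ zero → ¬ P
indicator≡0⇒¬ (no ¬p) _ = ¬p

-- Turns equality of unordered pairs into two orderings, so that a coloring can be checked on each.
-- Distinctness of the points of `p` excludes the collapsed cases.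
⟪⟫-injective : (p q : Pair X) → ⟪ p ⟫ ≐ ⟪ q ⟫ → let open Pair in
               (fst p ≡ fst q × snd p ≡ snd q) ⊎ (fst p ≡ snd q × snd p ≡ fst q)
⟪⟫-injective (pair x y x≢y) (pair u v _) (p⊆q , _)
  with p⊆q (inj₁ refl) | p⊆q (inj₂ refl)
... | inj₁ refl | inj₁ refl = ⊥-elim (x≢y refl)
... | inj₁ refl | inj₂ refl = inj₁ (refl , refl)
... | inj₂ refl | inj₁ refl = inj₂ (refl , refl)
... | inj₂ refl | inj₂ refl = ⊥-elim (x≢y refl)

⟪⟫-⊆ : ∀ {A : Pred X 0ℓ} {x y} (x≢y : x ≢ y) → x ∈ A → y ∈ A → ⟪ pair x y x≢y ⟫ ⊆ A
⟪⟫-⊆ _ x∈A _   (inj₁ refl) = x∈A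
⟪⟫-⊆ _ _   y∈A (inj₂ refl) = y∈A

m-n+n≡m : ∀ m n → m ≡ (m - n) + n
m-n+n≡m = solve-∀

[g+m]-[g+n]≡m-n : ∀ g m n → (g + m) - (g + n) ≡ m - n
[g+m]-[g+n]≡m-n = solve-∀

-[m-n]≡n-m : ∀ m n → - (m - n) ≡ n - m
-[m-n]≡n-m = ⁻¹-anti-homo‿- +-0-abelianGroup

-- Put `g = x - y`, which is nonzero. Then `a = g + b` and `x = g + y` both lie in `(g ⊕ A) ∩ A`, so
-- thinness identifies them; cancellation then gives `b ≡ y`.
oneThin⇒difference-injective :
  ∀ {A} → OneThin A → ∀ {a b x y} → a ∈ A → b ∈ A → x ∈ A → y ∈ A →
  x ≢ y → a - b ≡ x - y → a ≡ x × b ≡ y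
oneThin⇒difference-injective thin {a} {b} {x} {y} a∈A b∈A x∈A y∈A x≢y a-b≡x-y =
  a≡x , neg-injective (∙-cancelˡ +-0-abelianGroup x (- b) (- y) (subst (λ z → z - b ≡ x - y) a≡x a-b≡x-y))
  where
  a≡x : a ≡ x
  a≡x = thin (x - y) (x≢y ∘ i-j≡0⇒i≡j x y)
    ((b , b∈A , trans (m-n+n≡m a b) (cong (_+ b) a-b≡x-y)) , a∈A)
    ((y , y∈A , m-n+n≡m x y) , x∈A)

module _ (em : ExcludedMiddle 0ℓ) {D : Pred ℤ 0ℓ} (D-neg : ∀ d → d ∈ D → - d ∈ D) where

  differenceColor : Pair ℤ → Fin 2
  differenceColor (pair x y _) = indicator (em {D (x - y)})

  -- An unordered pair determines its difference only up to sign, so `D-neg` is what makes the color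
  -- well defined.
  differenceColoring : Coloring ℤ
  differenceColoring = record
    { to   = differenceColor
    ; cong = λ {p} {q} p≐q → color-cong p q (⟪⟫-injective p q p≐q)
    }
    where
    open Pair
    color-cong : ∀ p q →
      (fst p ≡ fst q × snd p ≡ snd q) ⊎ (fst p ≡ snd q × snd p ≡ fst q) →
      differenceColor p ≡ differenceColor q
    color-cong _ _ (inj₁ (refl , refl)) = refl
    color-cong (pair x y _) _ (inj₂ (refl , refl)) = indicator-cong
      (mk⇔ (subst D (-[m-n]≡n-m x y) ∘ D-neg _) (subst D (-[m-n]≡n-m y x) ∘ D-neg _)) em em

  differenceColoring-invariant : Invariant differenceColoring
  differenceColoring-invariant g (pair x y _) =
    cong (λ d → indicator (em {D d})) ([g+m]-[g+n]≡m-n g x y)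

-- Only distinct points are compared: a reflexive `R` such as `SameCell` would otherwise rule out
-- the negated alternative on every inhabited set.
Homogeneous : Rel X 0ℓ → Pred X 0ℓ → Set
Homogeneous R S = ∀ {x y} → x ∈ S → y ∈ S → x ≢ y → R x y

-- The symmetric relation `R` stands for a 2-coloring of pairs. It is encoded in a set `D` of
-- differences, and the color of `D` is read back as `R` inside `A`.
ℤRamsey∧oneThin⇒Ramsey :
  {𝒰 : Family ℤ ℓ} → IsℤRamsey 𝒰 → ∀ {A} → OneThin A → A ∈ 𝒰 →
  {R : Rel ℤ 0ℓ} → Symmetric R →
  ∃[ S ] S ∈ 𝒰 × (Homogeneous R S ⊎ Homogeneous (λ x y → ¬ R x y) S)
ℤRamsey∧oneThin⇒Ramsey {𝒰 = 𝒰} isR {A} thin A∈𝒰 {R} R-sym =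
  homogeneous (IsℤRamsey.ramsey isR χ (differenceColoring-invariant em D-neg))
  where
  isU = IsFreeUltrafilter.isUltrafilter (IsℤRamsey.isFreeUltrafilter isR)

  em : ExcludedMiddle 0ℓ
  em = ultrafilter⇒excludedMiddle isU

  -- Differences not realised by an `R`-related pair in `A` get color 0 by default; this is
  -- harmless, since colors are read back only on pairs from `A`.
  D : Pred ℤ 0ℓ
  D d = ∃[ a ] ∃[ b ] a ∈ A × b ∈ A × a - b ≡ d × R a b

  D-neg : ∀ d → d ∈ D → - d ∈ D
  D-neg _ (a , b , a∈A , b∈A , refl , Rab) =
    b , a , b∈A , a∈A , sym (-[m-n]≡n-m a b) , R-sym Rab

  -- Thinness enters here: the pair witnessing `x - y ∈ D` must be `(x , y)` itself.
  D⇒R : ∀ {x y} → x ∈ A → y ∈ A → x ≢ y → x - y ∈ D → R x y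
  D⇒R x∈A y∈A x≢y (a , b , a∈A , b∈A , a-b≡x-y , Rab)
    with refl , refl ← oneThin⇒difference-injective thin a∈A b∈A x∈A y∈A x≢y a-b≡x-y = Rab

  χ : Coloring ℤ
  χ = differenceColoring em D-neg

  homogeneous : ∃[ U ] U ∈ 𝒰 × ConstantOn χ U →
                ∃[ S ] S ∈ 𝒰 × (Homogeneous R S ⊎ Homogeneous (λ x y → ¬ R x y) S)
  homogeneous (U , U∈𝒰 , suc zero , const) =
    U ∩ A , IsUltrafilter.meet isU U∈𝒰 A∈𝒰 ,
    inj₁ λ (x∈U , x∈A) (y∈U , y∈A) x≢y →
      D⇒R x∈A y∈A x≢y (indicator≡1⇒ em (const (pair _ _ x≢y) (⟪⟫-⊆ x≢y x∈U y∈U)))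
  homogeneous (U , U∈𝒰 , zero , const) =
    U ∩ A , IsUltrafilter.meet isU U∈𝒰 A∈𝒰 ,
    -- If `R x y` held, `x` and `y` themselves would witness `x - y ∈ D`, against color 0.
    inj₂ λ (x∈U , x∈A) (y∈U , y∈A) x≢y Rxy →
      indicator≡0⇒¬ em (const (pair _ _ x≢y) (⟪⟫-⊆ x≢y x∈U y∈U))
        (_ , _ , x∈A , y∈A , refl , Rxy)

module _ {𝒫 : Family X p} (isP : IsPartition 𝒫) where
  open IsPartition isP

  cell : X → Pred X 0ℓ
  cell x = proj₁ (covers x)

  cell∈𝒫 : ∀ x → cell x ∈ 𝒫
  cell∈𝒫 x = proj₁ (proj₂ (covers x))

  ∈-cell : ∀ x → x ∈ cell x
  ∈-cell x = proj₂ (proj₂ (covers x))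

  -- Phrased with cell, not by quantifying over 𝒫, to remain at level 0ℓ.
  SameCell : Rel X 0ℓ
  SameCell x y = y ∈ cell x

  -- Both `C` and `cell x` contain `x`, so disjointness makes them equal.
  sameCell : ∀ {C x y} → C ∈ 𝒫 → x ∈ C → y ∈ C → SameCell x y
  sameCell {x = x} C∈𝒫 x∈C = proj₁ (disjoint C∈𝒫 (cell∈𝒫 x) x∈C (∈-cell x))

  sameCell-sym : Symmetric SameCell
  sameCell-sym {x} {y} y∈cell = sameCell (cell∈𝒫 x) y∈cell (∈-cell x)

theorem6 : ∀ {ℓ p : Level} (𝒰 : Family ℤ ℓ) →
    IsℤRamsey 𝒰 → ℤ⁺ ∈ 𝒰 →
    (∃[ A ] OneThin A × A ∈ 𝒰) → IsSelective p 𝒰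
theorem6 {p = p} 𝒰 isR _ (A , thin , A∈𝒰) = record
  { isFreeUltrafilter = IsℤRamsey.isFreeUltrafilter isR
  ; selects           = selects
  }
  where
  open IsUltrafilter
    (IsFreeUltrafilter.isUltrafilter (IsℤRamsey.isFreeUltrafilter isR))

  selects : (𝒫 : Family ℤ p) → IsPartition 𝒫 →
            (∃[ C ] C ∈ 𝒫 × C ∈ 𝒰) ⊎
            (∃[ S ] S ∈ 𝒰 × (∀ {C} → C ∈ 𝒫 → AtMostOne (S ∩ C)))
  selects 𝒫 isP
    with ℤRamsey∧oneThin⇒Ramsey isR thin A∈𝒰 {SameCell isP} (sameCell-sym isP)
  -- Any point `x` of `S` will do: all of `S` lies in its cell, which is therefore a member of `𝒰`.
  ... | S , S∈𝒰 , inj₁ same with x , x∈S ← nonempty S∈𝒰 =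
    inj₁ (cell isP x , cell∈𝒫 isP x , upward S∈𝒰 S⊆cell)
    where
    S⊆cell : S ⊆ cell isP x
    S⊆cell {y} y∈S with x ≟ y
    ... | yes refl = ∈-cell isP x
    ... | no x≢y   = same x∈S y∈S x≢y
  -- Here `S` itself is the selector: two distinct points of it in one cell would be related by
  -- `SameCell`.
  ... | S , S∈𝒰 , inj₂ different = inj₂ (S , S∈𝒰 , atMostOne)
    where
    atMostOne : ∀ {C} → C ∈ 𝒫 → AtMostOne (S ∩ C)
    atMostOne C∈𝒫 {x} {y} (x∈S , x∈C) (y∈S , y∈C) with x ≟ y
    ... | yes x≡y = x≡y
    ... | no x≢y  = ⊥-elim (different x∈S y∈S x≢y (sameCell isP C∈𝒫 x∈C y∈C))
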